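{- Let $m=m(n)=\omega(n)$, let $\varepsilon>0$, and suppose that the NOF Multiphase Game Conjecture holds for 3-round protocols with exponent $\varepsilon$ and $k=m$. Then for every fixed depth $d\ge1$ there exists a matrix $A\in\{0,1\}^{m\times n}$ such that any depth-$d$ circuit, with arbitrary gates and unbounded fan-in, computing the operator $x\mapsto Ax$ over the Boolean semiring requires $n^{1+\Omega(\varepsilon/d)}$ wires. In particular, for $d=2$, there is an $A$ such that computing $Ax$ requires $n^{1+\frac{\varepsilon}{2}-o(1)}$ wires.
   Context: Boolean semiring: addition is $\vee$ and multiplication is $\wedge$, so $(Ax)_i=\bigvee_{j}(A_{ij}\wedge x_j)$ for $x\in\{0,1\}^n$. Circuits: layered/acyclic circuits with $n$ input bits and $m$ output gates, in which each gate computes an arbitrary Boolean function of its in-neighbours, fan-in unbounded; depth is the maximal length of an input–output path, size is the number of wires (edges). Statements are asymptotic as $n\to\infty$. Multiphase game (3-party Number-On-Forehead): the input is $\vec S=(S_1,\dots,S_k)$ with $S_i\subseteq[n]$, $T\subseteq[n]$, and $i\in[k]$. Alice sees $(\vec S,i)$, Bob sees $(T,i)$, Charlie sees $(\vec S,T)$ but not $i$. The goal is to decide whether $S_i\cap T=\emptyset$. A protocol $(U,\Pi)$: Charlie first sends a message $U=U(\vec S,T)$ privately to Bob; then Alice and Bob communicate back and forth, each of Alice's messages being a function of $(\vec S,i)$ and the Alice–Bob transcript so far and each of Bob's a function of $(T,i,U)$ and the Alice–Bob transcript so far. $\Pi$ is the Alice–Bob transcript, which determines the answer; $|U|,|\Pi|$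 are worst-case bit lengths. A 3-round protocol is one in which the Alice–Bob stage consists of (at most) three messages: Alice to Bob, Bob to Alice, and Alice's final message announcing the answer. NOF Multiphase Game Conjecture for 3-round protocols, with exponent $\varepsilon>0$ and $k=k(n)$: for every family (indexed by $n$) of 3-round protocols solving the Multiphase game on all inputs with $|U|=o(k)$, one has $|\Pi|>n^{\varepsilon}$ for all sufficiently large $n$. -}

module Defs where

open import Data.Bool.Base using (Bool; true; false; _∧_; _∨_)
open import Data.Fin.Base using (Fin; zero; suc; _↑ˡ_)
open import Data.Fin.Subset using (Subset; Empty; _∩_)
open import Data.Integer.Base as ℤ using (ℤ)
open import Data.List.Base using (List; []; _∷_; _++_; length)
open import Data.Nat.Base using (ℕ; zero; suc; _+_; _*_; _^_; _≤_; _<_)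
open import Data.Product.Base using (∃; ∃-syntax; _×_)
open import Data.Rational.Base as ℚ using (ℚ; 0ℚ; ↥_; ↧ₙ_)
open import Data.Vec.Base using (Vec; []; _∷_; map; lookup; zipWith; foldr′)
open import Data.Vec.Membership.Propositional using (_∈_)
open import Function.Bundles using (_⇔_)
open import Relation.Binary.PropositionalEquality using (_≡_)

Eventually : (ℕ → Set) → Set
Eventually P = ∃[ N ] ∀ n → N ≤ n → P n

-- m(n) = ω(n)
Superlinear : (ℕ → ℕ) → Set
Superlinear m = ∀ c → Eventually λ n → c * n ≤ m n

TendsToZero : (ℕ → ℚ) → Set
TendsToZero η = ∀ δ → 0ℚ ℚ.< δ → Eventually λ n → ℚ.∣ η n ∣ ℚ.< δ

-- Two-sided Dedekind cuts of ℚ.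
record ℝ : Set₁ where
  field
    Lower Upper : ℚ → Set                       -- q < x,  x < q
    lower-down  : ∀ {p q} → p ℚ.< q → Lower q → Lower p
    lower-open  : ∀ {p} → Lower p → ∃[ q ] p ℚ.< q × Lower q
    upper-up    : ∀ {p q} → p ℚ.< q → Upper p → Upper q
    upper-open  : ∀ {q} → Upper q → ∃[ p ] p ℚ.< q × Upper p
    disjoint    : ∀ {p q} → Lower p → Upper q → p ℚ.< q
    -- Both sides are inhabited, and there is no gap between them.
    located     : ∀ δ → 0ℚ ℚ.< δ → ∃[ p ] Lower p × Upper (p ℚ.+ δ)

open ℝ public

Positive : ℝ → Set
Positive x = Lower x 0ℚ

-- For b ≥ 1 and s = p / q:  b ^ s ∼ a  iff  b ^ p ∼ a ^ q.
module Power (_∼_ : ℕ → ℕ → Set) where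
  compare : ℕ → ℤ → ℕ → ℕ → Set
  compare b (ℤ.+ p)      q a = (b ^ p) ∼ (a ^ q)
  compare b (ℤ.-[1+ p ]) q a = 1 ∼ (b ^ suc p * a ^ q)

_^ℚ_≤_ _^ℚ_<_ : ℕ → ℚ → ℕ → Set
b ^ℚ s ≤ a = Power.compare _≤_ b (↥ s) (↧ₙ s) a
b ^ℚ s < a = Power.compare _<_ b (↥ s) (↧ₙ s) a

-- b ^ x < a, where b ^ x is the infimum of b ^ r over rational r > x.
_^ℝ_<_ : ℕ → ℝ → ℕ → Set
b ^ℝ x < a = ∃[ r ] Upper x r × b ^ℚ r < a

-- b ^ (u + v x) ≤ a for rational u and v > 0, where b ^ (u + v x) is the
-- supremum of b ^ (u + v r) over rational r < x.
_^[_+_·_]≤_ : ℕ → ℚ → ℚ → ℝ → ℕ → Set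
b ^[ u + v · x ]≤ a = ∀ r → Lower x r → b ^ℚ (u ℚ.+ v ℚ.* r) ≤ a

Matrix : ℕ → ℕ → Set
Matrix m n = Vec (Vec Bool n) m

_·ᵥ_ : ∀ {m n} → Matrix m n → Vec Bool n → Vec Bool m
A ·ᵥ x = map (λ row → foldr′ _∨_ false (zipWith _∧_ row x)) A

-- Repeated sources are parallel wires, each of which is counted.
record Gate (N : ℕ) : Set where
  field
    {fan-in} : ℕ
    sources  : Vec (Fin N) fan-in
    function : Vec Bool fan-in → Bool

open Gate

-- An acyclic network with n inputs and g gates, listed in a topological order.
-- Nodes are numbered from the most recent gate: the g gates, newest first,
-- followed by the n inputs.
data Net (n : ℕ) : ℕ → Set where
  inputs : Net n 0
  _▷_    : ∀ {g} → Net n g → Gate (g + n) → Net n (suc g)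

values : ∀ {n g} → Net n g → Vec Bool n → Vec Bool (g + n)
values inputs  x = x
values (N ▷ G) x =
  let v = values N x in function G (map (lookup v) (sources G)) ∷ v

netWires : ∀ {n g} → Net n g → ℕ
netWires inputs  = 0
netWires (N ▷ G) = fan-in G + netWires N

-- Path N v ℓ: a directed path of ℓ wires from some input to the node v.
data Path {n : ℕ} : ∀ {g} → Net n g → Fin (g + n) → ℕ → Set where
  start : ∀ i → Path inputs i 0
  step  : ∀ {g ℓ u} {N : Net n g} {G : Gate (g + n)} →
          u ∈ sources G → Path N u ℓ → Path (N ▷ G) zero (suc ℓ)
  older : ∀ {g ℓ u} {N : Net n g} {G : Gate (g + n)} →
          Path N u ℓ → Path (N ▷ G) (suc u) ℓ

-- Output gates are not required to be sinks, nor to be distinct.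
record Circuit (n m : ℕ) : Set where
  field
    {gates} : ℕ
    net     : Net n gates
    outputs : Vec (Fin gates) m

  wires : ℕ
  wires = netWires net

  eval : Vec Bool n → Vec Bool m
  eval x = map (λ o → lookup (values net x) (o ↑ˡ n)) outputs

  -- The maximal length of an input–output path is at most d.
  Depth≤ : ℕ → Set
  Depth≤ d = ∀ {o ℓ} → o ∈ outputs → Path net (o ↑ˡ n) ℓ → ℓ ≤ d

open Circuit public using (wires; eval; Depth≤)

Computes : ∀ {m n} → Circuit n m → Matrix m n → Set
Computes C A = ∀ x → eval C x ≡ A ·ᵥ x

RequiresWires : ∀ {m n} → ℕ → Matrix m n → (ℕ → Set) → Set
RequiresWires {m} {n} d A P =
  ∀ (C : Circuit n m) → Depth≤ C d → Computes C A → P (wires C)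

Message : Set
Message = List Bool

-- The last message is the answer bit.  Shorter conversations are obtained by
-- letting earlier messages be empty.
record Protocol (n k : ℕ) : Set where
  field
    charlie : Vec (Subset n) k → Subset n → Message
    alice   : Vec (Subset n) k → Fin k → Message
    bob     : Subset n → Fin k → (U : Message) → (a : Message) → Message
    answer  : Vec (Subset n) k → Fin k → (a b : Message) → Bool

  module Run (S : Vec (Subset n) k) (T : Subset n) (i : Fin k) where
    U a b : Message
    U = charlie S T
    a = alice S i
    b = bob T i U a

    result : Bool
    result = answer S i a b

    Π : Message
    Π = a ++ b ++ result ∷ []

  Solves : Set
  Solves = ∀ S T i → Run.result S T i ≡ true ⇔ Empty (lookup S i ∩ T)

open Protocol

-- Lengths are worst-case: a maximum over inputs is at most a bound iff this
-- holds for all inputs, and exceeds it iff this happens for some input.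
MultiphaseConjecture₃ : ℝ → (ℕ → ℕ) → Set
MultiphaseConjecture₃ ε k =
  ∀ (P : ∀ n → Protocol n (k n)) → (∀ n → Solves (P n)) →
  (∀ c → Eventually λ n → ∀ S T → c * length (charlie (P n) S T) ≤ k n) →
  Eventually λ n → ∃[ S ] ∃[ T ] ∃[ i ] n ^ℝ ε < length (Run.Π (P n) S T i)

{-# OPTIONS --safe #-}
-- In a circuit with fewer than (t + 1)(n + 1) wires at most n gates have fan-in
-- above t.  Charlie sends the values of these heavy gates, which is o(k) bits
-- because k = ω(n).  Below an output, every path then stops at a heavy gate or at
-- an input after at most d gates of fan-in ≤ t, so the output is a function of
-- K = t ^ d bits known to Bob; Alice names them, with about log n bits each, and
-- Bob returns them.  With t ≈ n ^ (x / d) for a rational x < ε this transcript is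
-- shorter than n ^ ε, so the conjecture yields a matrix that has no such circuit.
-- Whether a matrix admits data of this kind is decidable, which lets Alice and
-- Charlie fall back on a trivial protocol for the other matrices.
module Submission where

open import Data.Bool.Base using (Bool; true; false; not; _∧_; _∨_)
import Data.Bool.Properties as Bool
open import Data.Fin.Base using (Fin; zero; suc; combine; finToFun; funToFin; inject≤; _↑ˡ_)
open import Data.Fin.Properties using (any?; all?; 2↔Bool; funToFin-finToFin; finToFun-funToFin; inject≤-injective)
open import Data.Fin.Subset using (Subset; Empty; _∩_)
open import Data.Fin.Subset.Properties using (anySubset?; drop-∷-Empty)
open import Data.Integer.Base as ℤ using (+_; -[1+_]; +≤+; +<+)
import Data.Integer.Properties as ℤ
open import Data.List.Base as List using (List; []; _∷_; length)
open import Data.List.Properties using (length-++; length-map)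
open import Data.List.Relation.Unary.All using (All; []; _∷_)
open import Data.List.Relation.Unary.All.Properties using (++⁻ˡ; ++⁻ʳ; map⁻)
open import Data.Nat.Base as ℕ using (ℕ; NonZero; zero; suc; _+_; _*_; _^_; _/_; _%_; _⊔_; z≤n; s≤s; _≤′_; ≤′-refl; ≤′-step; >-nonZero)
open import Data.Nat.Coprimality using (1-coprimeTo)
open import Data.Nat.DivMod using (m≡m%n+[m/n]*n; m%n<n)
open import Data.Nat.Properties
open import Data.Nat.Solver using (module +-*-Solver)
open import Data.Product.Base using (∃; ∃-syntax; _×_; _,_; proj₁; proj₂)
open import Data.Rational.Base as ℚ using (ℚ; mkℚ; 0ℚ; 1ℚ; ½; ↥_; ↧_; *≤*; *<*; toℚᵘ)
import Data.Rational.Properties as ℚ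
open import Data.Rational.Solver using () renaming (module +-*-Solver to ℚ-Solver)
open import Data.Rational.Unnormalised.Base as ℚᵘ using (mkℚᵘ; 1ℚᵘ)
import Data.Rational.Unnormalised.Properties as ℚᵘ
open import Data.Sum.Base using (_⊎_; inj₁; inj₂)
open import Data.Vec.Base as Vec using (Vec; []; _∷_; _++_; lookup; map; tabulate; toList)
open import Data.Vec.Membership.Propositional using (_∈_)
open import Data.Vec.Membership.Propositional.Properties using (∈-lookup)
open import Data.Vec.Properties using (≡-dec; lookup-map; lookup∘tabulate; length-toList)
open import Data.Vec.Relation.Unary.Any using (here; there)
open import Function.Base using (_∘_)
open import Function.Bundles using (_⇔_; mk⇔; Equivalence; Injection; Inverse)
open import Function.Properties.Inverse using (↔⇒↣)
open import Relation.Binary.PropositionalEquality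
open import Relation.Nullary using (Dec; yes; no; does; ¬_; contradiction; ¬?)
open import Relation.Nullary.Decidable using (map′; _×-dec_; _→-dec_; decidable-stable)
open import Relation.Unary using (Decidable)
open import Defs

open Gate
open Protocol

-- Gates of large fan-in

Determines : ∀ {n M} {B : Set} → (Vec Bool n → Vec Bool M) → List (Fin M) → (Vec Bool n → B) → Set
Determines f qs g = ∀ x y → All (λ q → lookup (f x) q ≡ lookup (f y) q) qs → g x ≡ g y

determines-suc : ∀ {n M} {B : Set} {f : Vec Bool n → Vec Bool M} {b : Vec Bool n → Bool} {qs} {g : Vec Bool n → B} →
                 Determines f qs g → Determines (λ x → b x ∷ f x) (List.map suc qs) g
determines-suc det x y eqs = det x y (map⁻ eqs)

-- The bound on the depth says nothing about a node that no input reaches, but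
-- such a node is constant and needs no queries.
Probe : ∀ {n g H} → ℕ → Net n g → (Vec Bool n → Vec Bool H) → Fin (g + n) → Set
Probe t N mem v = ∃[ qs ] Determines (λ x → mem x ++ x) qs (λ x → lookup (values N x) v) ×
  (qs ≡ [] ⊎ ∃[ ℓ ] Path N v ℓ × length qs ℕ.≤ t ^ ℓ)

-- The query lists of the sources are concatenated. The longest of the paths found bounds the whole
-- total, since `t ^ ℓ` is monotone in `ℓ` for nonzero `t`.
probe-sources : ∀ {n g H k} t .{{_ : NonZero t}} (N : Net n g) (mem : Vec Bool n → Vec Bool H) →
  (∀ v → Probe t N mem v) → (us : Vec (Fin (g + n)) k) →
  ∃[ qs ] Determines (λ x → mem x ++ x) qs (λ x → map (lookup (values N x)) us) ×
    (qs ≡ [] ⊎ ∃[ u ] ∃[ ℓ ] u ∈ us × Path N u ℓ × length qs ℕ.≤ k * t ^ ℓ)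
probe-sources t N mem probes [] = [] , (λ _ _ _ → refl) , inj₁ refl
probe-sources {k = suc k} t N mem probes (u ∷ us)
  with probes u | probe-sources t N mem probes us
... | qs , det , size | qs′ , det′ , size′ = qs List.++ qs′ , det″ , size″ size size′
  where
  det″ : Determines (λ x → mem x ++ x) (qs List.++ qs′) (λ x → map (lookup (values N x)) (u ∷ us))
  det″ x y eqs = cong₂ _∷_ (det x y (++⁻ˡ qs eqs)) (det′ x y (++⁻ʳ qs eqs))

  size″ : (qs ≡ [] ⊎ ∃[ ℓ ] Path N u ℓ × length qs ℕ.≤ t ^ ℓ) →
          (qs′ ≡ [] ⊎ ∃[ v ] ∃[ ℓ ] v ∈ us × Path N v ℓ × length qs′ ℕ.≤ k * t ^ ℓ) →
          qs List.++ qs′ ≡ [] ⊎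
          ∃[ v ] ∃[ ℓ ] v ∈ (u ∷ us) × Path N v ℓ × length (qs List.++ qs′) ℕ.≤ suc k * t ^ ℓ
  size″ (inj₁ refl) (inj₁ refl) = inj₁ refl
  size″ (inj₁ refl) (inj₂ (v , ℓ , v∈ , p , le)) =
    inj₂ (v , ℓ , there v∈ , p , ≤-trans le (m≤n+m _ _))
  size″ (inj₂ (ℓ , p , le)) (inj₁ refl) =
    inj₂ (u , ℓ , here refl , p , (begin
      length (qs List.++ [])  ≡⟨ length-++ qs ⟩
      length qs + 0           ≤⟨ +-mono-≤ le z≤n ⟩
      suc k * t ^ ℓ           ∎))
    where open ≤-Reasoning
  size″ (inj₂ (ℓ , p , le)) (inj₂ (v , ℓ′ , v∈ , p′ , le′)) with ≤-total ℓ ℓ′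
  ... | inj₁ ℓ≤ℓ′ = inj₂ (v , ℓ′ , there v∈ , p′ , (begin
      length (qs List.++ qs′)   ≡⟨ length-++ qs ⟩
      length qs + length qs′    ≤⟨ +-mono-≤ (≤-trans le (^-monoʳ-≤ t ℓ≤ℓ′)) le′ ⟩
      suc k * t ^ ℓ′            ∎))
    where open ≤-Reasoning
  ... | inj₂ ℓ′≤ℓ = inj₂ (u , ℓ , here refl , p , (begin
      length (qs List.++ qs′)   ≡⟨ length-++ qs ⟩
      length qs + length qs′    ≤⟨ +-mono-≤ le (≤-trans le′ (*-monoʳ-≤ k (^-monoʳ-≤ t ℓ′≤ℓ))) ⟩
      suc k * t ^ ℓ             ∎))
    where open ≤-Reasoning

-- Induction on the gates, with one memory shared by all nodes. A gate of fan-in at most `t`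
-- inherits the queries of its sources; any other gate adds its value to the memory and pays for
-- that bit with its more than `t` wires.
probe-net : ∀ {n g} t .{{_ : NonZero t}} (N : Net n g) →
  ∃[ H ] ∃ λ (mem : Vec Bool n → Vec Bool H) → H * suc t ℕ.≤ netWires N × (∀ v → Probe t N mem v)
probe-net t inputs = 0 , (λ _ → []) , z≤n ,
  λ v → v ∷ [] , (λ { _ _ (eq ∷ []) → eq }) , inj₂ (0 , start v , ≤-refl)
probe-net {n} t (_▷_ {g} N G) with probe-net t N
... | H , mem , count , probes with probe-sources t N mem probes (sources G) | fan-in G ≤? t
...   | qs , det , size | yes light = H , mem , ≤-trans count (m≤n+m _ _) , probes′
  where
  size′ : (qs ≡ [] ⊎ ∃[ u ] ∃[ ℓ ] u ∈ sources G × Path N u ℓ × length qs ℕ.≤ fan-in G * t ^ ℓ) →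
          qs ≡ [] ⊎ ∃[ ℓ ] Path (N ▷ G) zero ℓ × length qs ℕ.≤ t ^ ℓ
  size′ (inj₁ eq) = inj₁ eq
  size′ (inj₂ (u , ℓ , u∈ , p , le)) =
    inj₂ (suc ℓ , step u∈ p , ≤-trans le (*-monoˡ-≤ (t ^ ℓ) light))

  probes′ : ∀ v → Probe t (N ▷ G) mem v
  probes′ zero = qs , (λ x y eqs → cong (function G) (det x y eqs)) , size′ size
  probes′ (suc v) with probes v
  ... | qsᵥ , detᵥ , inj₁ eq = qsᵥ , detᵥ , inj₁ eq
  ... | qsᵥ , detᵥ , inj₂ (ℓ , p , le) = qsᵥ , detᵥ , inj₂ (ℓ , older p , le)
...   | qs , det , size | no heavy = suc H , mem′ , +-mono-≤ (≰⇒> heavy) count , probes′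
  where
  mem′ : Vec Bool n → Vec Bool (suc H)
  mem′ x = lookup (values (N ▷ G) x) zero ∷ mem x

  probe-zero : (qs ≡ [] ⊎ ∃[ u ] ∃[ ℓ ] u ∈ sources G × Path N u ℓ × length qs ℕ.≤ fan-in G * t ^ ℓ) →
               Probe t (N ▷ G) mem′ zero
  -- With no queries below it the gate is constant. Querying its own bit would call for a path from
  -- an input, and there may be none.
  probe-zero (inj₁ refl) = [] , (λ x y _ → cong (function G) (det x y [])) , inj₁ refl
  probe-zero (inj₂ (u , ℓ , u∈ , p , _)) =
    zero ∷ [] , (λ { _ _ (eq ∷ []) → eq }) , inj₂ (suc ℓ , step u∈ p , m^n>0 t (suc ℓ))

  probes′ : ∀ v → Probe t (N ▷ G) mem′ v
  probes′ zero = probe-zero size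
  probes′ (suc v) with probes v
  ... | qsᵥ , detᵥ , inj₁ refl = [] , (λ x y _ → detᵥ x y []) , inj₁ refl
  ... | qsᵥ , detᵥ , inj₂ (ℓ , p , le) =
    List.map suc qsᵥ , determines-suc detᵥ ,
    inj₂ (ℓ , older p , ≤-trans (≤-reflexive (length-map suc qsᵥ)) le)

-- The quantifiers follow who sees what: the memory may depend on `x` but not on `i`, as for
-- Charlie, and the positions `qs` on `i` but not on `x`, as for Alice.
Sketch : ∀ {m n} → ℕ → ℕ → Matrix m n → Set
Sketch {m} {n} H K A = ∃ λ (mem : Vec Bool n → Vec Bool H) → ∀ i →
  ∃[ qs ] length qs ℕ.≤ K × Determines (λ x → mem x ++ x) qs (λ x → lookup (A ·ᵥ x) i)

sketch-mono : ∀ {m n H H′ K} (A : Matrix m n) → H ≤′ H′ → Sketch H K A → Sketch H′ K A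
sketch-mono A ≤′-refl s = s
sketch-mono A (≤′-step H≤) s with sketch-mono A H≤ s
... | mem , probes = (λ x → false ∷ mem x) , λ i →
  let qs , le , det = probes i in
  List.map suc qs , ≤-trans (≤-reflexive (length-map suc qs)) le , determines-suc det

-- The wire count leaves at most `n` stored bits, which `sketch-mono` pads to exactly `n`; the depth
-- bound caps every `t ^ ℓ` by `t ^ d`.
circuit⇒sketch : ∀ {m n} d t .{{_ : NonZero t}} (A : Matrix m n) (C : Circuit n m) →
  Depth≤ C d → Computes C A → wires C ℕ.< suc n * suc t → Sketch n (t ^ d) A
circuit⇒sketch {m} {n} d t A C depth computes few with probe-net t (Circuit.net C)
... | H , mem , count , probes =
  sketch-mono A (≤⇒≤′ (≤-pred (*-cancelʳ-< (suc t) H (suc n) (≤-<-trans count few)))) (mem , probe)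
  where
  out : Fin m → Fin _
  out i = lookup (Circuit.outputs C) i ↑ˡ n

  value : ∀ x i → lookup (values (Circuit.net C) x) (out i) ≡ lookup (A ·ᵥ x) i
  value x i = trans (sym (lookup-map i _ (Circuit.outputs C))) (cong (λ v → lookup v i) (computes x))

  probe : ∀ i → ∃[ qs ] length qs ℕ.≤ t ^ d × Determines (λ x → mem x ++ x) qs (λ x → lookup (A ·ᵥ x) i)
  probe i with probes (out i)
  ... | qs , det , size =
    qs , bound size , λ x y eqs → trans (sym (value x i)) (trans (det x y eqs) (value y i))
    where
    bound : (qs ≡ [] ⊎ ∃[ ℓ ] Path (Circuit.net C) (out i) ℓ × length qs ℕ.≤ t ^ ℓ) → length qs ℕ.≤ t ^ d
    bound (inj₁ refl) = z≤n
    bound (inj₂ (ℓ , p , le)) = ≤-trans le (^-monoʳ-≤ t (depth (∈-lookup i (Circuit.outputs C)) p))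

-- Deciding the existence of short queries

-- Functions on bit vectors as first-order data, so that a search over all of them is finite and
-- makes no appeal to function extensionality.
Table : Set → ℕ → Set
Table B zero    = B
Table B (suc n) = Table B n × Table B n

_at_ : ∀ {B n} → Table B n → Vec Bool n → B
_at_ {n = zero}  b        []          = b
_at_ {n = suc n} (s , t) (true ∷ x)  = s at x
_at_ {n = suc n} (s , t) (false ∷ x) = t at x

table : ∀ {B n} → (Vec Bool n → B) → Table B n
table {n = zero}  f = f []
table {n = suc n} f = table (f ∘ (true ∷_)) , table (f ∘ (false ∷_))

table-at : ∀ {B n} (f : Vec Bool n → B) x → table f at x ≡ f x
table-at f []          = refl
table-at f (true ∷ x)  = table-at (f ∘ (true ∷_)) x
table-at f (false ∷ x) = table-at (f ∘ (false ∷_)) x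

anyTable? : ∀ {B : Set} → (∀ {P : B → Set} → Decidable P → Dec (∃ P)) →
            ∀ n {P : Table B n → Set} → Decidable P → Dec (∃ P)
anyTable? any zero    P? = any P?
anyTable? any (suc n) P? =
  map′ (λ (s , t , p) → (s , t) , p) (λ ((s , t) , p) → s , t , p)
       (anyTable? any n λ s → anyTable? any n λ t → P? (s , t))

allSubset? : ∀ {n} {P : Subset n → Set} → Decidable P → Dec (∀ x → P x)
allSubset? P? = map′ (λ ¬∃ x → decidable-stable (P? x) λ ¬p → ¬∃ (x , ¬p)) (λ ∀p (x , ¬p) → ¬p (∀p x))
                     (¬? (anySubset? λ x → ¬? (P? x)))

-- The `K` positions are the base-`(n + n)` digits of one number `q`, which can be searched for
-- exhaustively and sent in binary.
replies : ∀ {n K} → Vec Bool n → Vec Bool n → Fin ((n + n) ^ K) → Vec Bool K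
replies u x q = tabulate λ k → lookup (u ++ x) (finToFun q k)

Suffices : ∀ {m n} K → Matrix m n → Table (Vec Bool n) n → Fin m → Fin ((n + n) ^ K) → Set
Suffices {m} {n} K A h i q = ∀ x y → replies (h at x) x q ≡ replies {n} {K} (h at y) y q →
                             lookup (A ·ᵥ x) i ≡ lookup (A ·ᵥ y) i

-- The finite counterpart of `Sketch n K A`. Charlie and Alice both see `A`, so by running the same
-- decision procedure they agree on memory and queries without communicating.
record Easy {m n : ℕ} (K : ℕ) (A : Matrix m n) : Set where
  constructor _,ₑ_
  field
    memory  : Table (Vec Bool n) n
    queries : ∀ i → ∃ (Suffices K A memory i)

easy? : ∀ {m n} K (A : Matrix m n) → Dec (Easy K A)
easy? {n = n} K A = map′ (λ (h , q) → h ,ₑ q) (λ (h ,ₑ q) → h , q) (anyTable? anySubset? n λ h → all? λ i → any? λ q →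
  allSubset? λ x → allSubset? λ y →
    ≡-dec Bool._≟_ (replies {n} {K} (h at x) x q) (replies (h at y) y q) →-dec (_ Bool.≟ _))

padTo : ∀ {B : Set} K → B → List B → Fin K → B
padTo (suc K) b []       k       = b
padTo (suc K) b (c ∷ cs) zero    = c
padTo (suc K) b (c ∷ cs) (suc k) = padTo K b cs k

padTo-All : ∀ {B : Set} {P : B → Set} K b cs → length cs ℕ.≤ K → (∀ k → P (padTo K b cs k)) → All P cs
padTo-All K       b []       _        ps = []
padTo-All (suc K) b (c ∷ cs) (s≤s le) ps = ps zero ∷ padTo-All K b cs le (ps ∘ suc)

sketch⇒easy : ∀ {m n K} .{{_ : NonZero n}} (A : Matrix m n) → Sketch n K A → Easy K A
sketch⇒easy {n = n@(suc _)} {K} A (mem , probes) = table mem ,ₑ λ i →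
  let qs , le , det = probes i
      -- Position zero exists because `n` is nonzero. The padding only adds replies on which `x` and
      -- `y` are assumed to agree.
      f = padTo K zero qs
      value : ∀ x k → lookup (replies {n} {K} (table mem at x) x (funToFin f)) k ≡ lookup (mem x ++ x) (f k)
      value x k = trans (lookup∘tabulate _ k)
        (cong₂ (λ u j → lookup (u ++ x) j) (table-at mem x) (finToFun-funToFin f k))
  in funToFin f , λ x y eq → det x y (padTo-All K zero qs le λ k →
       trans (sym (value x k)) (trans (cong (λ v → lookup v k) eq) (value y k)))

-- The protocol

disjoint⇔ : ∀ {m n} (A : Matrix m n) i x → lookup (A ·ᵥ x) i ≡ false ⇔ Empty (lookup A i ∩ x)
disjoint⇔ A i x rewrite lookup-map i (λ row → Vec.foldr′ _∨_ false (Vec.zipWith _∧_ row x)) A =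
  none⇔ (lookup A i ∩ x)
  where
  none⇔ : ∀ {n} (p : Subset n) → Vec.foldr′ _∨_ false p ≡ false ⇔ Empty p
  none⇔ []          = mk⇔ (λ _ ()) (λ _ → refl)
  none⇔ (true ∷ p)  = mk⇔ (λ ()) (λ empty → contradiction (zero , Vec.here) empty)
  none⇔ (false ∷ p) = mk⇔ (λ { _ (zero , ()) ; eq (suc k , Vec.there k∈p) → Equivalence.to (none⇔ p) eq (k , k∈p) })
                          (λ empty → Equivalence.from (none⇔ p) (drop-∷-Empty empty))

-- Messages have no length in their type, so a receiver reads a fixed number of bits; the default
-- `false` never shows on the messages actually sent.
resize : ∀ n → List Bool → Vec Bool n
resize zero    _        = []
resize (suc n) []       = false ∷ resize n []
resize (suc n) (b ∷ bs) = b ∷ resize n bs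

resize-toList : ∀ {n} (x : Vec Bool n) → resize n (toList x) ≡ x
resize-toList []      = refl
resize-toList (b ∷ x) = cong (b ∷_) (resize-toList x)

bits : ∀ {Q} ℓ → .(Q ℕ.≤ 2 ^ ℓ) → Fin Q → Vec Bool ℓ
bits ℓ Q≤2^ℓ q = tabulate λ k → Inverse.to 2↔Bool (finToFun (inject≤ q Q≤2^ℓ) k)

bits-injective : ∀ {Q} ℓ .(Q≤2^ℓ : Q ℕ.≤ 2 ^ ℓ) q q′ → bits ℓ Q≤2^ℓ q ≡ bits ℓ Q≤2^ℓ q′ → q ≡ q′
bits-injective {Q} ℓ Q≤2^ℓ q q′ eq = inject≤-injective Q≤2^ℓ Q≤2^ℓ q q′ (begin
  inject≤ q Q≤2^ℓ                                  ≡⟨ funToFin-finToFin {ℓ} (inject≤ q Q≤2^ℓ) ⟨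
  funToFin (finToFun {2} {ℓ} (inject≤ q Q≤2^ℓ))   ≡⟨ funToFin-cong digit ⟩
  funToFin (finToFun {2} {ℓ} (inject≤ q′ Q≤2^ℓ))  ≡⟨ funToFin-finToFin {ℓ} (inject≤ q′ Q≤2^ℓ) ⟩
  inject≤ q′ Q≤2^ℓ                                 ∎)
  where
  open ≡-Reasoning
  funToFin-cong : ∀ {k} {f g : Fin k → Fin 2} → (∀ j → f j ≡ g j) → funToFin f ≡ funToFin g
  funToFin-cong {zero}  f≗g = refl
  funToFin-cong {suc k} f≗g = cong₂ combine (f≗g zero) (funToFin-cong (f≗g ∘ suc))

  digit : ∀ k → finToFun (inject≤ q Q≤2^ℓ) k ≡ finToFun (inject≤ q′ Q≤2^ℓ) k
  digit k = Injection.injective (↔⇒↣ 2↔Bool)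
    (trans (sym (lookup∘tabulate _ k)) (trans (cong (λ v → lookup v k) eq) (lookup∘tabulate _ k)))

charlieMessage : ∀ {m n} K (A : Matrix m n) → Dec (Easy K A) → Subset n → Message
charlieMessage K A (yes (h ,ₑ _)) T = toList (h at T)
charlieMessage K A (no _)        T = []

-- Bob does not see `A` and must learn which protocol runs. The leading bit keeps the message
-- non-empty even when `ℓ` is zero; the empty message asks him for all of `T`.
aliceMessage : ∀ {m n} K (A : Matrix m n) ℓ → .((n + n) ^ K ℕ.≤ 2 ^ ℓ) → Dec (Easy K A) → Fin m → Message
aliceMessage K A ℓ Q≤2^ℓ (yes (_ ,ₑ q)) i = true ∷ toList (bits ℓ Q≤2^ℓ (proj₁ (q i)))
aliceMessage K A ℓ Q≤2^ℓ (no _)        i = []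

decode? : ∀ {Q} ℓ (Q≤2^ℓ : Q ℕ.≤ 2 ^ ℓ) (v : Vec Bool ℓ) → Dec (∃ λ q → bits ℓ Q≤2^ℓ q ≡ v)
decode? ℓ Q≤2^ℓ v = any? λ q → ≡-dec Bool._≟_ (bits ℓ Q≤2^ℓ q) v

bobReply : ∀ {n K} → Vec Bool n → Vec Bool n → {P : Fin ((n + n) ^ K) → Set} → Dec (∃ P) → Message
bobReply {K = K} u T (yes (q , _)) = toList (replies {K = K} u T q)
bobReply u T (no _)                = []

bobMessage : ∀ {n} K ℓ → (n + n) ^ K ℕ.≤ 2 ^ ℓ → Subset n → (U a : Message) → Message
bobMessage K ℓ Q≤2^ℓ T U []      = toList T
bobMessage K ℓ Q≤2^ℓ T U (_ ∷ a) = bobReply {K = K} (resize _ U) T (decode? ℓ Q≤2^ℓ (resize ℓ a))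

-- Alice does not see `T`, so she looks for any input with the received replies and entry `false`.
-- By `Suffices` all inputs with these replies, `T` among them, agree at `i`, so one witness settles
-- the answer.
consistent? : ∀ {m n} K (A : Matrix m n) (h : Table (Vec Bool n) n) i (q : Fin ((n + n) ^ K)) (b : Message) →
  Dec (∃ λ x → replies {n} {K} (h at x) x q ≡ resize K b × lookup (A ·ᵥ x) i ≡ false)
consistent? {n = n} K A h i q b = anySubset? λ x →
  ≡-dec Bool._≟_ (replies {n} {K} (h at x) x q) (resize K b) ×-dec (lookup (A ·ᵥ x) i Bool.≟ false)

aliceAnswer : ∀ {m n} K (A : Matrix m n) → Dec (Easy K A) → Fin m → (b : Message) → Bool
aliceAnswer K A (yes (h ,ₑ q)) i b = does (consistent? K A h i (proj₁ (q i)) b)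
aliceAnswer K A (no _)        i b = not (lookup (A ·ᵥ resize _ b) i)

bobMessage-replies : ∀ {n} K ℓ (Q≤2^ℓ : (n + n) ^ K ℕ.≤ 2 ^ ℓ) T (u : Vec Bool n) q →
  bobMessage K ℓ Q≤2^ℓ T (toList u) (true ∷ toList (bits ℓ Q≤2^ℓ q)) ≡ toList (replies {K = K} u T q)
bobMessage-replies K ℓ Q≤2^ℓ T u q
  rewrite resize-toList u | resize-toList (bits ℓ Q≤2^ℓ q)
  with decode? ℓ Q≤2^ℓ (bits ℓ Q≤2^ℓ q)
... | yes (q′ , eq) = cong (λ r → toList (replies {K = K} u T r)) (bits-injective ℓ Q≤2^ℓ q′ q eq)
... | no ¬∃         = contradiction (q , refl) ¬∃

length-messages : ∀ {j k} (a : Vec Bool j) (b : Vec Bool k) {c} →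
  length (toList a List.++ toList b List.++ c ∷ []) ≡ j + (k + 1)
length-messages a b {c} = begin
  length (toList a List.++ toList b List.++ c ∷ [])     ≡⟨ length-++ (toList a) ⟩
  length (toList a) + length (toList b List.++ c ∷ [])  ≡⟨ cong (λ l → length (toList a) + l) (length-++ (toList b)) ⟩
  length (toList a) + (length (toList b) + 1)           ≡⟨ cong₂ (λ j k → j + (k + 1)) (length-toList a) (length-toList b) ⟩
  _                                                     ∎
  where open ≡-Reasoning

abstract
  protocol : ∀ {m n} K ℓ → (n + n) ^ K ℕ.≤ 2 ^ ℓ → Protocol n m
  protocol K ℓ Q≤2^ℓ = record
    { charlie = λ A T → charlieMessage K A (easy? K A) T
    ; alice   = λ A i → aliceMessage K A ℓ Q≤2^ℓ (easy? K A) i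
    ; bob     = λ T i U a → bobMessage K ℓ Q≤2^ℓ T U a
    ; answer  = λ A i a b → aliceAnswer K A (easy? K A) i b
    }

  protocol-solves : ∀ {m n} K ℓ (Q≤2^ℓ : (n + n) ^ K ℕ.≤ 2 ^ ℓ) → Solves (protocol {m} {n} K ℓ Q≤2^ℓ)
  protocol-solves {n = n} K ℓ Q≤2^ℓ A T i =
    mk⇔ (Equivalence.to (disjoint⇔ A i T) ∘ Equivalence.to (correct (easy? K A)))
        (Equivalence.from (correct (easy? K A)) ∘ Equivalence.from (disjoint⇔ A i T))
    where
    correct : (e : Dec (Easy K A)) →
      aliceAnswer K A e i (bobMessage K ℓ Q≤2^ℓ T (charlieMessage K A e T) (aliceMessage K A ℓ Q≤2^ℓ e i)) ≡ true
      ⇔ lookup (A ·ᵥ T) i ≡ false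
    correct (no _) rewrite resize-toList T with lookup (A ·ᵥ T) i
    ... | true  = mk⇔ (λ ()) (λ ())
    ... | false = mk⇔ (λ _ → refl) (λ _ → refl)
    correct (yes (h ,ₑ q)) rewrite bobMessage-replies K ℓ Q≤2^ℓ T (h at T) (proj₁ (q i))
      with consistent? K A h i (proj₁ (q i)) (toList (replies {n} {K} (h at T) T (proj₁ (q i))))
    ... | yes (x , eq , off) =
      mk⇔ (λ _ → trans (proj₂ (q i) T x (sym (trans eq (resize-toList _)))) off) (λ _ → refl)
    ... | no ¬∃ = mk⇔ (λ ()) (λ off → contradiction (T , sym (resize-toList _) , off) ¬∃)

  charlie-length : ∀ {m n} K ℓ (Q≤2^ℓ : (n + n) ^ K ℕ.≤ 2 ^ ℓ) (A : Matrix m n) T →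
    length (charlie (protocol K ℓ Q≤2^ℓ) A T) ℕ.≤ n
  charlie-length K ℓ Q≤2^ℓ A T with easy? K A
  ... | yes (h ,ₑ _) = ≤-reflexive (length-toList (h at T))
  ... | no _        = z≤n

  -- Alice's flag and `ℓ` bits, then `K` replies and the answer. `Easy` excludes the fallback, which
  -- costs `n + 1` bits.
  transcript-length : ∀ {m n} K ℓ (Q≤2^ℓ : (n + n) ^ K ℕ.≤ 2 ^ ℓ) (A : Matrix m n) T i → Easy K A →
    length (Run.Π (protocol K ℓ Q≤2^ℓ) A T i) ≡ suc ℓ + (K + 1)
  transcript-length {n = n} K ℓ Q≤2^ℓ A T i easy with easy? K A
  ... | no ¬easy    = contradiction easy ¬easy
  ... | yes (h ,ₑ q) rewrite bobMessage-replies K ℓ Q≤2^ℓ T (h at T) (proj₁ (q i)) =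
    cong suc (length-messages (bits ℓ Q≤2^ℓ (proj₁ (q i))) (replies {n} {K} (h at T) T (proj₁ (q i))))

-- Powers and logarithms

-- Downward search from `B`; it yields integer roots, logarithms and the diagonal index.
crossing : ∀ {P : ℕ → Set} → Decidable P → P 0 → ∀ B → ¬ P B → ∃[ t ] P t × ¬ P (suc t)
crossing P? P0 zero    ¬PB = contradiction P0 ¬PB
crossing P? P0 (suc B) ¬PB with P? B
... | yes PB = B , PB , ¬PB
... | no ¬PB′ = crossing P? P0 B ¬PB′

^-distribʳ-* : ∀ k m n → (m * n) ^ k ≡ m ^ k * n ^ k
^-distribʳ-* zero    m n = refl
^-distribʳ-* (suc k) m n = trans (cong (m * n *_) (^-distribʳ-* k m n)) (interchange m n (m ^ k) (n ^ k))
  where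
  interchange : ∀ m n x y → m * n * (x * y) ≡ m * x * (n * y)
  interchange = solve 4 (λ m n x y → m :* n :* (x :* y) := m :* x :* (n :* y)) refl
    where open +-*-Solver

^-comm : ∀ m j k → (m ^ j) ^ k ≡ (m ^ k) ^ j
^-comm m j k = trans (^-*-assoc m j k) (trans (cong (m ^_) (*-comm j k)) (sym (^-*-assoc m k j)))

^-cancelʳ-≤ : ∀ k .{{_ : NonZero k}} {m n} → m ^ k ℕ.≤ n ^ k → m ℕ.≤ n
^-cancelʳ-≤ k {m} {n} le with m ≤? n
... | yes m≤n = m≤n
... | no m≰n  = contradiction le (<⇒≱ (^-monoˡ-< k (≰⇒> m≰n)))

^-cancelʳ-< : ∀ k {m n} → m ^ k ℕ.< n ^ k → m ℕ.< n
^-cancelʳ-< k {m} {n} lt with n ≤? m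
... | yes n≤m = contradiction (^-monoˡ-≤ k n≤m) (<⇒≱ lt)
... | no n≰m  = ≰⇒> n≰m

n<2^n : ∀ n → n ℕ.< 2 ^ n
n<2^n zero    = s≤s z≤n
n<2^n (suc n) = +-mono-≤ (m^n>0 2 n) (≤-trans (n<2^n n) (m≤m+n _ 0))

abstract
  root : ∀ e .{{_ : NonZero e}} X → ∃[ t ] t ^ e ℕ.≤ X × X ℕ.< suc t ^ e
  root e@(suc e-1) X with crossing (λ t → t ^ e ≤? X) z≤n (suc X) too-large
    where
    too-large : ¬ suc X ^ e ℕ.≤ X
    too-large le = <-irrefl refl (≤-trans (m≤m*n (suc X) (suc X ^ e-1) {{m^n≢0 (suc X) e-1}}) le)
  ... | t , below , above = t , below , ≰⇒> above

  log₂ : ∀ n → ∃[ ℓ ] 2 ^ ℓ ℕ.≤ 1 ⊔ n × n ℕ.< 2 ^ suc ℓ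
  -- The maximum with 1 admits the exponent 0 when `n` is zero.
  log₂ n with crossing (λ ℓ → 2 ^ ℓ ≤? 1 ⊔ n) (m≤m⊔n 1 n) (1 ⊔ n) (<⇒≱ (n<2^n (1 ⊔ n)))
  ... | ℓ , below , above = ℓ , below , ≤-<-trans (m≤n⊔m 1 n) (≰⇒> above)

-- The bound `z < 2 ^ z` is applied to the quotient `z = ℓ / e`: the base is linear in `z`, and the
-- `e`-th power of `2 ^ z` is still at most `2 ^ ℓ`.
polynomial≤exponential : ∀ c e .{{_ : NonZero e}} ℓ → (c + ℓ) ^ e ℕ.≤ (c + e) ^ e * 2 ^ ℓ
polynomial≤exponential c e ℓ = begin
  (c + ℓ) ^ e                     ≤⟨ ^-monoˡ-≤ e linear ⟩
  ((c + e) * 2 ^ z) ^ e           ≡⟨ ^-distribʳ-* e (c + e) (2 ^ z) ⟩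
  (c + e) ^ e * (2 ^ z) ^ e       ≡⟨ cong ((c + e) ^ e *_) (^-*-assoc 2 z e) ⟩
  (c + e) ^ e * 2 ^ (z * e)       ≤⟨ *-monoʳ-≤ ((c + e) ^ e) (^-monoʳ-≤ 2 ze≤ℓ) ⟩
  (c + e) ^ e * 2 ^ ℓ             ∎
  where
  open ≤-Reasoning
  z = ℓ / e
  ze≤ℓ : z * e ℕ.≤ ℓ
  ze≤ℓ = ≤-trans (m≤n+m (z * e) (ℓ % e)) (≤-reflexive (sym (m≡m%n+[m/n]*n ℓ e)))
  linear : c + ℓ ℕ.≤ (c + e) * 2 ^ z
  linear = begin
    c + ℓ                       ≡⟨ cong (λ l → c + l) (m≡m%n+[m/n]*n ℓ e) ⟩
    c + (ℓ % e + z * e)         ≤⟨ +-monoʳ-≤ c (+-monoˡ-≤ (z * e) (<⇒≤ (m%n<n ℓ e))) ⟩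
    c + (e + z * e)             ≡⟨ +-assoc c e (z * e) ⟨
    (c + e) + z * e             ≤⟨ +-monoʳ-≤ (c + e) (*-monoʳ-≤ z (m≤n+m e c)) ⟩
    suc z * (c + e)             ≡⟨ *-comm (suc z) (c + e) ⟩
    (c + e) * suc z             ≤⟨ *-monoʳ-≤ (c + e) (n<2^n z) ⟩
    (c + e) * 2 ^ z             ∎

abstract
  -- The preceding bound is used at exponent `suc e`: the extra factor `c + ℓ` eventually exceeds
  -- the constant `C` and cancels it.
  polynomial-eventually≤exponential : ∀ c .{{_ : NonZero c}} e → Eventually λ ℓ → (c + ℓ) ^ e ℕ.≤ 2 ^ ℓ
  polynomial-eventually≤exponential c@(suc _) e = C , λ ℓ C≤ℓ → *-cancelˡ-≤ C {{m^n≢0 (c + suc e) (suc e)}} (begin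
    C * (c + ℓ) ^ e         ≤⟨ *-monoˡ-≤ ((c + ℓ) ^ e) (≤-trans C≤ℓ (m≤n+m ℓ c)) ⟩
    (c + ℓ) ^ suc e         ≤⟨ polynomial≤exponential c (suc e) ℓ ⟩
    C * 2 ^ ℓ               ∎)
    where
    open ≤-Reasoning
    C : ℕ
    C = (c + suc e) ^ suc e

-- Hard matrices

-- The conjecture supplies inputs with a long transcript, and the family of sets among them is the
-- matrix. Charlie's at most `n` bits are `o(m)` because `m` is superlinear.
hard-inputs : ∀ {m ε} → MultiphaseConjecture₃ ε m → Superlinear m →
  (K ℓ : ℕ → ℕ) (Q≤2^ℓ : ∀ n → (n + n) ^ K n ℕ.≤ 2 ^ ℓ n) →
  ∃ λ (A : ∀ n → Matrix (m n) n) → Eventually λ n →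
    Easy (K n) (A n) → n ^ℝ ε < (suc (ℓ n) + (K n + 1))
hard-inputs {m} {ε} conjecture superlinear K ℓ Q≤2^ℓ = proj₁ ∘ choice , N , λ n → proj₂ (choice n)
  where
  P : ∀ n → Protocol n (m n)
  P n = protocol (K n) (ℓ n) (Q≤2^ℓ n)

  short : ∀ c → Eventually λ n → ∀ S T → c * length (charlie (P n) S T) ℕ.≤ m n
  short c = let M , large = superlinear c in M , λ n M≤n S T →
    ≤-trans (*-monoʳ-≤ c (charlie-length (K n) (ℓ n) (Q≤2^ℓ n) S T)) (large n M≤n)

  long : Eventually λ n → ∃[ S ] ∃[ T ] ∃[ i ] n ^ℝ ε < length (Run.Π (P n) S T i)
  long = conjecture P (λ n → protocol-solves (K n) (ℓ n) (Q≤2^ℓ n)) short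
  N = proj₁ long

  choice : ∀ n → ∃ λ (A : Matrix (m n) n) → N ℕ.≤ n → Easy (K n) A → n ^ℝ ε < (suc (ℓ n) + (K n + 1))
  choice n with N ≤? n
  -- Below the threshold the conjecture gives no input, and the zero matrix fills in.
  ... | no N≰n = Vec.replicate _ (Vec.replicate _ false) , λ N≤n → contradiction N≤n N≰n
  ... | yes N≤n = let A , T , i , lt = proj₂ long n N≤n in A , λ _ easy →
    subst (n ^ℝ ε <_) (transcript-length (K n) (ℓ n) (Q≤2^ℓ n) A T i easy) lt

-- Here a / b < u / v < ε, and the bound on the wires is n ^ (1 + (a / b) / d).
lower-bound : ∀ {m ε} → MultiphaseConjecture₃ ε m → Superlinear m →
  ∀ a b d u v .{{_ : NonZero b}} .{{_ : NonZero d}} → a * v ℕ.< u * b →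
  (∀ n .{{_ : NonZero n}} s → n ^ℝ ε < s → n ^ u ℕ.< s ^ v) →
  ∃ λ (A : ∀ n → Matrix (m n) n) → Eventually λ n →
    RequiresWires d (A n) λ w → n ^ (b * d + a) ℕ.≤ w ^ (b * d)
lower-bound {m} {ε} conjecture superlinear a b d u v av<ub long⇒ =
  A , N₁ ⊔ 2 ^ E , bound
  where
  instance
    bd≢0 : NonZero (b * d)
    bd≢0 = m*n≢0 b d

  t log K ℓ : ℕ → ℕ
  -- `t` is `n ^ (a / (b * d))` rounded down, so that `K` is at most `n ^ (a / b)`. Each position is
  -- below `2 ^ (2 + log n)`, whence `ℓ`.
  t n = proj₁ (root (b * d) (n ^ a))
  log n = proj₁ (log₂ n)
  K n = t n ^ d
  ℓ n = (2 + log n) * K n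

  Q≤2^ℓ : ∀ n → (n + n) ^ K n ℕ.≤ 2 ^ ℓ n
  Q≤2^ℓ n = begin
    (n + n) ^ K n                 ≤⟨ ^-monoˡ-≤ (K n) (+-mono-≤ n≤ (≤-trans n≤ (m≤m+n _ 0))) ⟩
    (2 ^ (2 + log n)) ^ K n        ≡⟨ ^-*-assoc 2 (2 + log n) (K n) ⟩
    2 ^ ℓ n                       ∎
    where
    open ≤-Reasoning
    n≤ = <⇒≤ (proj₂ (proj₂ (log₂ n)))

  hard = hard-inputs {m} {ε} conjecture superlinear K ℓ Q≤2^ℓ
  A  = proj₁ hard
  N₁ = proj₁ (proj₂ hard)

  -- The 5 comes from `length≤`. From `2 ^ E` on, the logarithmic factor to the power `b * v` is at
  -- most `n`.
  E = proj₁ (polynomial-eventually≤exponential 5 (b * v))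

  t≢0 : ∀ n .{{_ : NonZero n}} → NonZero (t n)
  t≢0 n = >-nonZero (≤-pred (^-cancelʳ-< (b * d) (begin-strict
    1 ^ (b * d)           ≡⟨ ^-zeroˡ (b * d) ⟩
    1                     ≤⟨ m^n>0 n a ⟩
    n ^ a                 <⟨ proj₂ (proj₂ (root (b * d) (n ^ a))) ⟩
    suc (t n) ^ (b * d)   ∎)))
    where open ≤-Reasoning

  polylog : ∀ n .{{_ : NonZero n}} → 2 ^ E ℕ.≤ n → (5 + log n) ^ (b * v) ℕ.≤ n
  polylog n@(suc _) 2^E≤n =
    ≤-trans (proj₂ (polynomial-eventually≤exponential 5 (b * v)) (log n) E≤log) (proj₁ (proj₂ (log₂ n)))
    where
    E≤log : E ℕ.≤ log n
    E≤log = ≮⇒≥ λ log<E → <⇒≱ (proj₂ (proj₂ (log₂ n))) (≤-trans (^-monoʳ-≤ 2 log<E) 2^E≤n)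

  -- After raising to the power `b`, the strict inequality `a * v < u * b` leaves one spare factor
  -- `n`, which absorbs the power of `5 + log n`.
  short : ∀ n .{{_ : NonZero n}} → 2 ^ E ℕ.≤ n → (suc (ℓ n) + (K n + 1)) ^ v ℕ.≤ n ^ u
  short n 2^E≤n = ^-cancelʳ-≤ b (begin
    ((suc (ℓ n) + (K n + 1)) ^ v) ^ b        ≡⟨ trans (^-*-assoc (suc (ℓ n) + (K n + 1)) v b) (cong ((suc (ℓ n) + (K n + 1)) ^_) (*-comm v b)) ⟩
    (suc (ℓ n) + (K n + 1)) ^ (b * v)        ≤⟨ ^-monoˡ-≤ (b * v) length≤ ⟩
    (K n * (5 + log n)) ^ (b * v)             ≡⟨ ^-distribʳ-* (b * v) (K n) (5 + log n) ⟩
    K n ^ (b * v) * (5 + log n) ^ (b * v)     ≤⟨ *-mono-≤ K≤ (polylog n 2^E≤n) ⟩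
    n ^ (a * v) * n                          ≡⟨ *-comm _ n ⟩
    n ^ suc (a * v)                          ≤⟨ ^-monoʳ-≤ n av<ub ⟩
    n ^ (u * b)                              ≡⟨ ^-*-assoc n u b ⟨
    (n ^ u) ^ b                              ∎)
    where
    open ≤-Reasoning
    K>0 : 1 ℕ.≤ K n
    K>0 = m^n>0 (t n) {{t≢0 n}} d

    expand : ∀ k l → suc ((2 + l) * k) + (k + 1) ≡ k * (3 + l) + 2
    expand = solve 2 (λ k l → con 1 :+ (con 2 :+ l) :* k :+ (k :+ con 1) := k :* (con 3 :+ l) :+ con 2) refl
      where open +-*-Solver

    collect : ∀ k l → k * (3 + l) + 2 * k ≡ k * (5 + l)
    collect = solve 2 (λ k l → k :* (con 3 :+ l) :+ con 2 :* k := k :* (con 5 :+ l)) refl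
      where open +-*-Solver

    length≤ : suc (ℓ n) + (K n + 1) ℕ.≤ K n * (5 + log n)
    length≤ = begin
      suc (ℓ n) + (K n + 1)           ≡⟨ expand (K n) (log n) ⟩
      K n * (3 + log n) + 2            ≤⟨ +-monoʳ-≤ (K n * (3 + log n)) (*-monoʳ-≤ 2 K>0) ⟩
      K n * (3 + log n) + 2 * K n      ≡⟨ collect (K n) (log n) ⟩
      K n * (5 + log n)                ∎

    K≤ : K n ^ (b * v) ℕ.≤ n ^ (a * v)
    K≤ = begin
      (t n ^ d) ^ (b * v)     ≡⟨ ^-*-assoc (t n ^ d) b v ⟨
      ((t n ^ d) ^ b) ^ v     ≡⟨ cong (_^ v) (trans (^-*-assoc (t n) d b) (cong (t n ^_) (*-comm d b))) ⟩
      (t n ^ (b * d)) ^ v     ≤⟨ ^-monoˡ-≤ v (proj₁ (proj₂ (root (b * d) (n ^ a)))) ⟩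
      (n ^ a) ^ v             ≡⟨ ^-*-assoc n a v ⟩
      n ^ (a * v)             ∎

  bound : ∀ n → N₁ ⊔ 2 ^ E ℕ.≤ n → RequiresWires d (A n) λ w → n ^ (b * d + a) ℕ.≤ w ^ (b * d)
  bound n n≥ C depth computes with suc n * suc (t n) ≤? wires C
  ... | yes many = begin
    n ^ (b * d + a)                          ≡⟨ ^-distribˡ-+-* n (b * d) a ⟩
    n ^ (b * d) * n ^ a                      ≤⟨ *-mono-≤ (^-monoˡ-≤ (b * d) (n≤1+n n)) (<⇒≤ (proj₂ (proj₂ (root (b * d) (n ^ a))))) ⟩
    suc n ^ (b * d) * suc (t n) ^ (b * d)    ≡⟨ ^-distribʳ-* (b * d) (suc n) (suc (t n)) ⟨
    (suc n * suc (t n)) ^ (b * d)            ≤⟨ ^-monoˡ-≤ (b * d) many ⟩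
    wires C ^ (b * d)                        ∎
    where open ≤-Reasoning
  -- Too few wires make `A n` easy; its transcript would then be longer than `n ^ (u / v)`, against
  -- `short`.
  ... | no few = contradiction (short n 2^E≤n) (<⇒≱ (long⇒ n _ (proj₂ (proj₂ hard) n (m⊔n≤o⇒m≤o N₁ _ n≥) easy)))
    where
    2^E≤n : 2 ^ E ℕ.≤ n
    2^E≤n = m⊔n≤o⇒n≤o N₁ (2 ^ E) n≥

    instance
      n≢0 : NonZero n
      n≢0 = >-nonZero (≤-trans (m^n>0 2 E) 2^E≤n)

    easy : Easy (K n) (A n)
    easy = sketch⇒easy (A n) (circuit⇒sketch d (t n) {{t≢0 n}} (A n) C depth computes (≰⇒> few))

-- Rational exponents

root⇒^ℚ≤ : ∀ n .{{_ : NonZero n}} s p q .{{_ : NonZero q}} w →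
  ↥ s ℤ.* + q ℤ.≤ + p ℤ.* ↧ s → n ^ p ℕ.≤ w ^ q → n ^ℚ s ≤ w
root⇒^ℚ≤ n (mkℚ (+ u) v-1 _) p q w us≤ n^p≤w^q = ^-cancelʳ-≤ q (begin
  (n ^ u) ^ q     ≡⟨ ^-*-assoc n u q ⟩
  n ^ (u * q)     ≤⟨ ^-monoʳ-≤ n (ℤ.drop‿+≤+ (subst₂ ℤ._≤_ (sym (ℤ.pos-* u q)) (sym (ℤ.pos-* p v)) us≤)) ⟩
  n ^ (p * v)     ≡⟨ ^-*-assoc n p v ⟨
  (n ^ p) ^ v     ≤⟨ ^-monoˡ-≤ v n^p≤w^q ⟩
  (w ^ q) ^ v     ≡⟨ ^-comm w q v ⟩
  (w ^ v) ^ q     ∎)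
  where
  open ≤-Reasoning
  v = suc v-1
-- For a negative exponent it is enough that `w` is positive, which `1 ≤ n ^ p ≤ w ^ q` forces.
root⇒^ℚ≤ n (mkℚ -[1+ u ] v-1 _) p q w _ n^p≤w^q =
  *-mono-≤ (m^n>0 n (suc u)) (m^n>0 w {{w≢0}} (suc v-1))
  where
  w≢0 : NonZero w
  w≢0 = >-nonZero (^-cancelʳ-< q (≤-trans (≤-reflexive (cong suc (0^q q))) (≤-trans (m^n>0 n p) n^p≤w^q)))
    where
    0^q : ∀ q .{{_ : NonZero q}} → 0 ^ q ≡ 0
    0^q (suc _) = refl

^ℚ<⇒power : ∀ n .{{_ : NonZero n}} r u v s →
  + u ℤ.* ↧ r ℤ.< ↥ r ℤ.* + v → .{{_ : NonZero v}} → n ^ℚ r < s → n ^ u ℕ.< s ^ v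
^ℚ<⇒power n (mkℚ -[1+ _ ] _ _) u (suc v-1) s u<r _ =
  contradiction (ℤ.<-trans (ℤ.≤-<-trans (subst (ℤ.0ℤ ℤ.≤_) (ℤ.pos-* u _) (+≤+ z≤n)) u<r) ℤ.-<+) (ℤ.<-irrefl refl)
^ℚ<⇒power n (mkℚ (+ p) q-1 _) u v s u<r n^p<s^q = ^-cancelʳ-< q (begin-strict
  (n ^ u) ^ q     ≡⟨ ^-*-assoc n u q ⟩
  n ^ (u * q)     ≤⟨ ^-monoʳ-≤ n (<⇒≤ (ℤ.drop‿+<+ (subst₂ ℤ._<_ (sym (ℤ.pos-* u q)) (sym (ℤ.pos-* p v)) u<r))) ⟩
  n ^ (p * v)     ≡⟨ ^-*-assoc n p v ⟨
  (n ^ p) ^ v     <⟨ ^-monoˡ-< v n^p<s^q ⟩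
  (s ^ q) ^ v     ≡⟨ ^-comm s q v ⟩
  (s ^ v) ^ q     ∎)
  where
  open ≤-Reasoning
  q = suc q-1

-- For `x = a / b` the bound `1 + x / d` is the fraction `(b * d + a) / (b * d)`. In unnormalised
-- rationals it is read off without reduction to lowest terms.
exponent≤ : ∀ x d-1 s → s ℚ.≤ 1ℚ ℚ.+ x ℚ.* (+ 1 ℚ./ suc d-1) →
  ↥ s ℤ.* + (ℚ.↧ₙ x * suc d-1) ℤ.≤ (+ (ℚ.↧ₙ x * suc d-1) ℤ.+ ↥ x) ℤ.* ↧ s
exponent≤ x@record{} d-1 s s≤ = subst₂ ℤ._≤_
  (cong₂ ℤ._*_ (ℚ.↥ᵘ-toℚᵘ s) (cong +_ (*-identityˡ bd)))
  (cong₂ ℤ._*_ numerator (ℚ.↧ᵘ-toℚᵘ s)) (ℚᵘ.drop-*≤* s≤ᵘ)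
  where
  bd = ℚ.↧ₙ x * suc d-1

  s≤ᵘ : toℚᵘ s ℚᵘ.≤ 1ℚᵘ ℚᵘ.+ toℚᵘ x ℚᵘ.* mkℚᵘ (+ 1) d-1
  s≤ᵘ = ℚᵘ.≤-respʳ-≃
    (ℚᵘ.≃-trans (ℚ.toℚᵘ-homo-+ 1ℚ (x ℚ.* (+ 1 ℚ./ suc d-1)))
      (ℚᵘ.+-congʳ 1ℚᵘ (ℚᵘ.≃-trans (ℚ.toℚᵘ-homo-* x (+ 1 ℚ./ suc d-1))
        (ℚᵘ.*-congˡ {toℚᵘ x} (ℚ.toℚᵘ-fromℚᵘ (mkℚᵘ (+ 1) d-1))))))
    (ℚ.toℚᵘ-mono-≤ s≤)

  numerator : + 1 ℤ.* + bd ℤ.+ (↥ x ℤ.* + 1) ℤ.* + 1 ≡ + bd ℤ.+ ↥ x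
  numerator = cong₂ ℤ._+_ (ℤ.*-identityˡ (+ bd))
                          (trans (ℤ.*-identityʳ (↥ x ℤ.* + 1)) (ℤ.*-identityʳ (↥ x)))

-- Openness of the lower cut puts a rational `ρ = u / v` between `x` and `ε`; the gap from `x` to
-- `ρ` pays for the logarithmic factor in the transcript.
rational-lower-bound : ∀ {m} ε → MultiphaseConjecture₃ ε m → Superlinear m →
  ∀ d .{{_ : NonZero d}} x → 0ℚ ℚ.≤ x → Lower ε x →
  ∃ λ (A : ∀ n → Matrix (m n) n) → Eventually λ n →
    RequiresWires d (A n) λ w → ∀ s → s ℚ.≤ 1ℚ ℚ.+ x ℚ.* (+ 1 ℚ./ d) → n ^ℚ s ≤ w
rational-lower-bound ε conjecture superlinear d (mkℚ -[1+ _ ] _ _) (*≤* ()) x<ε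
rational-lower-bound {m} ε conjecture superlinear d@(suc d-1) x@(mkℚ (+ a) b-1 _) 0≤x x<ε
  with lower-open ε x<ε
... | mkℚ -[1+ _ ] _ _ , x<ρ , _ = contradiction (ℚ.≤-<-trans 0≤x x<ρ) λ { (*<* ()) }
... | ρ@(mkℚ (+ u) v-1 _) , *<* x<ρ , ρ<ε =
  A , N ⊔ 1 , λ n n≥ C depth computes s s≤ →
    root⇒^ℚ≤ n {{>-nonZero (m⊔n≤o⇒n≤o N 1 n≥)}} s (suc b-1 * d + a) (suc b-1 * d) (wires C)
      (exponent≤ x d-1 s s≤) (bound n (m⊔n≤o⇒m≤o N 1 n≥) C depth computes)
  where
  long⇒ : ∀ n .{{_ : NonZero n}} s → n ^ℝ ε < s → n ^ u ℕ.< s ^ suc v-1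
  long⇒ n s (r , ε<r , n^r<s) = ^ℚ<⇒power n r u (suc v-1) s (ℚ.drop-*<* (disjoint ε ρ<ε ε<r)) n^r<s

  result = lower-bound {m} {ε} conjecture superlinear a (suc b-1) d u (suc v-1)
    (ℤ.drop‿+<+ (subst₂ ℤ._<_ (sym (ℤ.pos-* a (suc v-1))) (sym (ℤ.pos-* u (suc b-1))) x<ρ)) long⇒
  A = proj₁ result
  N = proj₁ (proj₂ result)
  bound = proj₂ (proj₂ result)

-- `located` gives a lower approximation `p`; the maximum with `q` remains in the cut and can only
-- improve it.
approximation : ∀ ε {q δ} → Lower ε q → 0ℚ ℚ.< δ →
  ∃[ x ] q ℚ.≤ x × Lower ε x × (∀ r → Lower ε r → r ℚ.≤ x ℚ.+ δ)
approximation ε {q} {δ} q<ε 0<δ with located ε δ 0<δ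
... | p , p<ε , ε<p+δ = p ℚ.⊔ q , ℚ.p≤q⊔p p q , lower (ℚ.⊔-sel p q) , λ r r<ε →
  ℚ.<⇒≤ (ℚ.<-≤-trans (disjoint ε r<ε ε<p+δ) (ℚ.+-monoˡ-≤ δ (ℚ.p≤p⊔q p q)))
  where
  lower : p ℚ.⊔ q ≡ p ⊎ p ℚ.⊔ q ≡ q → Lower ε (p ℚ.⊔ q)
  lower (inj₁ eq) = subst (Lower ε) (sym eq) p<ε
  lower (inj₂ eq) = subst (Lower ε) (sym eq) q<ε

-- Diagonalisation

-- `M` is a strictly increasing majorant of `N`, and `j n` is the index with
-- `M (j n) ≤ n < M (suc (j n))`. The left bound gives `N (j n) ≤ n`; the right one drives `j n` to
-- infinity.
diagonal : ∀ (N : ℕ → ℕ) → ∃ λ (j : ℕ → ℕ) → (∀ k → Eventually λ n → k ℕ.≤ j n) × Eventually λ n → N (j n) ℕ.≤ n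
diagonal N = (λ n → proj₁ (choice n)) ,
  (λ k → M k , λ n Mk≤n → ≮⇒≥ λ j<k →
    <⇒≱ (proj₂ (proj₂ (choice n) (≤-trans (M-mono {0} {k} z≤n) Mk≤n))) (≤-trans (M-mono j<k) Mk≤n)) ,
  N 0 , λ n N0≤n → ≤-trans (N≤M _) (proj₁ (proj₂ (choice n) N0≤n))
  where
  M : ℕ → ℕ
  M zero    = N 0
  M (suc j) = suc (M j + N (suc j))

  N≤M : ∀ j → N j ℕ.≤ M j
  N≤M zero    = ≤-refl
  N≤M (suc j) = m≤n⇒m≤1+n (m≤n+m _ (M j))

  j≤M : ∀ j → j ℕ.≤ M j
  j≤M zero    = z≤n
  j≤M (suc j) = s≤s (≤-trans (j≤M j) (m≤m+n _ _))

  M-mono : ∀ {i j} → i ℕ.≤ j → M i ℕ.≤ M j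
  M-mono {i} {zero}  z≤n = ≤-refl
  M-mono {i} {suc j} i≤1+j with m≤n⇒m<n∨m≡n i≤1+j
  ... | inj₁ (s≤s i≤j) = m≤n⇒m≤1+n (≤-trans (M-mono i≤j) (m≤m+n _ _))
  ... | inj₂ refl      = ≤-refl

  choice : ∀ n → ∃[ j ] (N 0 ℕ.≤ n → M j ℕ.≤ n × n ℕ.< M (suc j))
  choice n with N 0 ≤? n
  ... | no N0≰n = 0 , λ N0≤n → contradiction N0≤n N0≰n
  ... | yes N0≤n with crossing (λ j → M j ≤? n) N0≤n (suc n) (<⇒≱ (j≤M (suc n)))
  ...   | j , below , above = j , λ _ → below , ≰⇒> above

1/1+_ : ℕ → ℚ
1/1+ j = mkℚ (+ 1) j (1-coprimeTo (suc j))

-- A positive rational is at least the reciprocal of its denominator, so it suffices that `j n`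
-- reaches that denominator.
1/1+-tendsToZero : ∀ {j : ℕ → ℕ} → (∀ k → Eventually λ n → k ℕ.≤ j n) → TendsToZero λ n → 1/1+ j n
1/1+-tendsToZero j→∞ (mkℚ (+ zero) _ _)     (*<* (+<+ ()))
1/1+-tendsToZero j→∞ (mkℚ -[1+ _ ] _ _)     (*<* ())
1/1+-tendsToZero {j} j→∞ (mkℚ (+ suc p) q-1 _) _ with j→∞ (suc q-1)
... | N , large = N , λ n N≤n → *<* (+<+ (begin-strict
  1 * suc q-1           ≡⟨ *-identityˡ (suc q-1) ⟩
  suc q-1               ≤⟨ large n N≤n ⟩
  j n                   <⟨ n<1+n (j n) ⟩
  suc (j n)             ≤⟨ m≤m+n (suc (j n)) _ ⟩
  suc p * suc (j n)     ∎))
  where open ≤-Reasoning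

-- The constant for fixed depth and the vanishing error for depth two

theorem1p5 : ∃[ c ] 0ℚ ℚ.< c ×
    (∀ (m : ℕ → ℕ) (ε : ℝ) → Superlinear m → Positive ε → MultiphaseConjecture₃ ε m →
    (∀ (d : ℕ) .{{_ : NonZero d}} →
    ∃ λ (A : ∀ n → Matrix (m n) n) → Eventually λ n →
    RequiresWires d (A n) λ w → n ^[ 1ℚ + c ℚ.* (+ 1 ℚ./ d) · ε ]≤ w)
    ×
    (∃ λ (A : ∀ n → Matrix (m n) n) → ∃[ η ] TendsToZero η × Eventually λ n →
    RequiresWires 2 (A n) λ w → n ^[ 1ℚ ℚ.- η n + ½ · ε ]≤ w))
theorem1p5 = ½ , ℚ.positive⁻¹ ½ , λ m ε superlinear 0<ε conjecture →
  any-depth m ε superlinear 0<ε conjecture , depth-two m ε superlinear 0<ε conjecture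
  where
  any-depth : ∀ m ε → Superlinear m → Positive ε → MultiphaseConjecture₃ ε m → ∀ d .{{_ : NonZero d}} →
    ∃ λ (A : ∀ n → Matrix (m n) n) → Eventually λ n →
      RequiresWires d (A n) λ w → n ^[ 1ℚ + ½ ℚ.* (+ 1 ℚ./ d) · ε ]≤ w
  -- A positive `q` in the cut serves both as lower bound for `x` and as error: every `r` below `ε`
  -- is at most `x + q ≤ x + x`, which explains the factor `½`.
  any-depth m ε superlinear 0<ε conjecture d with lower-open ε 0<ε
  ... | q , 0<q , q<ε with approximation ε q<ε 0<q
  ...   | x , q≤x , x<ε , below
    with rational-lower-bound ε conjecture superlinear d x (ℚ.<⇒≤ (ℚ.<-≤-trans 0<q q≤x)) x<ε
  ...     | A , N , bound = A , N , λ n N≤n C depth computes r r<ε →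
    bound n N≤n C depth computes _ (ℚ.+-monoʳ-≤ 1ℚ (begin
      ½ ℚ.* (+ 1 ℚ./ d) ℚ.* r           ≡⟨ swap ½ (+ 1 ℚ./ d) r ⟩
      ½ ℚ.* r ℚ.* (+ 1 ℚ./ d)           ≤⟨ ℚ.*-monoʳ-≤-nonNeg (+ 1 ℚ./ d) {{ℚ.normalize-nonNeg 1 d}}
                                             (ℚ.*-monoˡ-≤-nonNeg ½ (ℚ.≤-trans (below r r<ε) (ℚ.+-monoʳ-≤ x q≤x))) ⟩
      ½ ℚ.* (x ℚ.+ x) ℚ.* (+ 1 ℚ./ d)   ≡⟨ cong (ℚ._* (+ 1 ℚ./ d)) (half x) ⟩
      x ℚ.* (+ 1 ℚ./ d)                 ∎))
    where
    open ℚ.≤-Reasoning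
    swap : ∀ h e r → h ℚ.* e ℚ.* r ≡ h ℚ.* r ℚ.* e
    swap = solve 3 (λ h e r → h :* e :* r := h :* r :* e) refl
      where open ℚ-Solver
    half : ∀ x → ½ ℚ.* (x ℚ.+ x) ≡ x
    half = solve 1 (λ x → con ½ :* (x :+ x) := x) refl
      where open ℚ-Solver

  depth-two : ∀ m ε → Superlinear m → Positive ε → MultiphaseConjecture₃ ε m →
    ∃ λ (A : ∀ n → Matrix (m n) n) → ∃[ η ] TendsToZero η × Eventually λ n →
      RequiresWires 2 (A n) λ w → n ^[ 1ℚ ℚ.- η n + ½ · ε ]≤ w
  depth-two m ε superlinear 0<ε conjecture =
    -- Each fixed error has its own family of matrices and threshold; the diagonal index moves to
    -- smaller errors as soon as `n` passes their thresholds.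
    (λ n → A (j n) n) , (λ n → 1/1+ j n) , 1/1+-tendsToZero (proj₁ (proj₂ diag)) ,
    proj₁ (proj₂ (proj₂ diag)) , λ n n≥ C depth computes r r<ε →
      bound (j n) n (proj₂ (proj₂ (proj₂ diag)) n n≥) C depth computes _ (exponent (j n) r r<ε)
    where
    -- Depth two halves the error in `ε`, so twice `1/1+ i` is allowed here.
    2/1+_ : ℕ → ℚ
    2/1+ i = 1/1+ i ℚ.+ 1/1+ i

    approx : ∀ i → ∃[ x ] 0ℚ ℚ.≤ x × Lower ε x × (∀ r → Lower ε r → r ℚ.≤ x ℚ.+ 2/1+ i)
    approx i = approximation ε 0<ε (ℚ.positive⁻¹ (2/1+ i) {{ℚ.pos+pos⇒pos (1/1+ i) (1/1+ i)}})

    stage : ∀ i → ∃ λ (A : ∀ n → Matrix (m n) n) → Eventually λ n →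
      RequiresWires 2 (A n) λ w → ∀ s → s ℚ.≤ 1ℚ ℚ.+ proj₁ (approx i) ℚ.* ½ → n ^ℚ s ≤ w
    stage i = rational-lower-bound ε conjecture superlinear 2 (proj₁ (approx i))
      (proj₁ (proj₂ (approx i))) (proj₁ (proj₂ (proj₂ (approx i))))

    A     = λ i → proj₁ (stage i)
    bound = λ i → proj₂ (proj₂ (stage i))
    diag  = diagonal (λ i → proj₁ (proj₂ (stage i)))
    j     = proj₁ diag

    exponent : ∀ i r → Lower ε r → (1ℚ ℚ.- 1/1+ i) ℚ.+ ½ ℚ.* r ℚ.≤ 1ℚ ℚ.+ proj₁ (approx i) ℚ.* ½
    exponent i r r<ε = begin
      (1ℚ ℚ.- 1/1+ i) ℚ.+ ½ ℚ.* r                 ≤⟨ ℚ.+-monoʳ-≤ (1ℚ ℚ.- 1/1+ i) (ℚ.*-monoˡ-≤-nonNeg ½ (proj₂ (proj₂ (proj₂ (approx i))) r r<ε)) ⟩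
      (1ℚ ℚ.- 1/1+ i) ℚ.+ ½ ℚ.* (x ℚ.+ 2/1+ i)    ≡⟨ cancel x (1/1+ i) ⟩
      1ℚ ℚ.+ x ℚ.* ½                              ∎
      where
      open ℚ.≤-Reasoning
      x = proj₁ (approx i)
      cancel : ∀ x e → (1ℚ ℚ.- e) ℚ.+ ½ ℚ.* (x ℚ.+ (e ℚ.+ e)) ≡ 1ℚ ℚ.+ x ℚ.* ½
      cancel = solve 2 (λ x e → (con 1ℚ :- e) :+ con ½ :* (x :+ (e :+ e)) := con 1ℚ :+ x :* con ½) refl
        where open ℚ-Solver
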